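{- Let $x\in\mathbb{Z}^3$ be primitive with norm $nm^2$, where $n,m$ are positive integers and $n$ is squarefree, and let $(u,v,w)$ be an icube in $\mathbb{Z}^3$ of edge length $m$ whose cubic lattice contains $x$. Write $x=au+bv+cw$ with $a,b,c\in\mathbb{Z}$. (1) If none of $a,b,c$ is zero, then $x$ has no twin. (2) If exactly one of $a,b,c$ is zero, then $x$ has exactly two twins; if, say, $a=0$, these are $cv-bw$ and its negative. (3) If two of $a,b,c$ are zero, then $x$ has exactly four twins, and so is contained in a unique icube. If, say, $a=b=0$, then $c=\pm1$, $n=1$, and the twins of $x$ are $\pm u$ and $\pm v$. This case happens exactly when the norm of $x$ is a perfect square.
   Context: The norm of a vector in $\mathbb{Z}^3$ is its squared Euclidean length; a vector is primitive if the gcd of its components is $1$. An icube in $\mathbb{Z}^3$ is a triple $(u,v,w)$ of nonzero pairwise orthogonal vectors of $\mathbb{Z}^3$ of equal length (the edge length); its cubic lattice is the subgroup generated by $u,v,w$. A twin of a nonzero vector $x\in\mathbb{Z}^3$ is a vector $y\in\mathbb{Z}^3$ orthogonal to $x$ with the same length as $x$. -}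

module Defs where

open import Data.Nat as ℕ using (ℕ)
open import Data.Nat.Divisibility as ℕD using ()
open import Data.Integer using (ℤ; +_; _+_; _*_; -_; _-_; 0ℤ; 1ℤ)
open import Data.Integer.GCD using (gcd)
open import Data.Product using (_×_; _,_; Σ; ∃)
open import Data.List using (List)
open import Data.List.Membership.Propositional using (_∈_)
open import Data.List.Relation.Unary.Unique.Propositional using (Unique)
open import Function.Bundles using (_⇔_)
open import Relation.Binary.PropositionalEquality using (_≡_; _≢_)

record V3 : Set where
  constructor mkV
  field
    x₁ x₂ x₃ : ℤ
open V3 public

zeroV : V3
zeroV = mkV 0ℤ 0ℤ 0ℤ

_⊕_ : V3 → V3 → V3
mkV a b c ⊕ mkV a' b' c' = mkV (a + a') (b + b') (c + c')
infixl 6 _⊕_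

_·_ : ℤ → V3 → V3
k · mkV a b c = mkV (k * a) (k * b) (k * c)
infixl 7 _·_

negV : V3 → V3
negV v = (- 1ℤ) · v

_⊖_ : V3 → V3 → V3
u ⊖ v = u ⊕ negV v
infixl 6 _⊖_

dot : V3 → V3 → ℤ
dot (mkV a b c) (mkV a' b' c') = a * a' + b * b' + c * c'

norm : V3 → ℤ
norm v = dot v v

Primitive : V3 → Set
Primitive (mkV a b c) = gcd (gcd a b) c ≡ 1ℤ

IsIcube : V3 → V3 → V3 → Set
IsIcube u v w =
  u ≢ zeroV × v ≢ zeroV × w ≢ zeroV ×
  dot u v ≡ 0ℤ × dot u w ≡ 0ℤ × dot v w ≡ 0ℤ ×
  norm u ≡ norm v × norm v ≡ norm w

-- twin of x (x is assumed nonzero where used)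
Twin : V3 → V3 → Set
Twin x y = dot x y ≡ 0ℤ × norm y ≡ norm x

TwinsAre : V3 → List V3 → Set
TwinsAre x L = Unique L × (∀ y → Twin x y ⇔ (y ∈ L))

SquareFree : ℕ → Set
SquareFree n = ∀ d → (d ℕ.* d) ℕD.∣ n → d ≡ 1

IsPerfectSquare : ℤ → Set
IsPerfectSquare z = ∃ λ (k : ℕ) → z ≡ + (k ℕ.* k)

{-# OPTIONS --safe #-}
module Submission where

-- Write M = m². As u, v, w are pairwise orthogonal of norm M, the coordinate map
-- p ↦ p₁u + p₂v + p₃w multiplies dot products by M, so twins of x inside the cubic lattice
-- are the images of the twins of its coordinate vector q = (a, b, c), which has the
-- squarefree norm n. Every twin y of x does lie in the lattice: x is primitive, so x · e = 1
-- for some e, and for f = x × e the Gram determinant of (x, e, y) gives m ∣ f · y; expanding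
-- y · z in the basis x, e, f, whose determinant |f|² = |x|²|e|² − 1 is a unit modulo M,
-- then gives M ∣ y · z for z = u, v, w. Finally, if p is a twin of q then every coordinate of
-- q × p has its square divisible by n, so q × p = n t with t a signed unit vector
-- orthogonal to q, and p = t × q: a coordinate of q vanishes, and the twins can be read off.

open import Defs

module Squares where
  open import Data.Nat.Base
  open import Data.Nat.Properties using (*-identityˡ; [m*n]*[o*p]≡[m*o]*[n*p]; m*n≢0; *-comm; *-assoc; *-cancelʳ-≡)
  open import Data.Nat.Divisibility
  open import Data.Nat.GCD using (gcd; GCD; gcd-GCD; GCD-*; gcd[m,n]∣m; gcd[m,n]∣n; gcd[m,n]≢0)
  open import Data.Nat.Coprimality using (Coprime; GCD≡1⇒coprime; coprime-divisor)
  open import Data.Product using (∃; ∃₂; _×_; _,_)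
  open import Data.Sum using (_⊎_; inj₁; inj₂)
  open import Relation.Binary.PropositionalEquality

  gcd-cofactors : ∀ m k → .{{NonZero m}} →
    ∃₂ λ m′ k′ → ∃ λ g → NonZero g × m ≡ m′ * g × k ≡ k′ * g × Coprime m′ k′
  gcd-cofactors m k with gcd[m,n]∣m m k | gcd[m,n]∣n m k
  ... | divides m′ m≡m′g | divides k′ k≡k′g =
    m′ , k′ , gcd m k , g≢0 , m≡m′g , k≡k′g ,
    GCD≡1⇒coprime (GCD-* {{g≢0}} (subst₂ (λ i j → GCD i j (1 * gcd m k)) m≡m′g k≡k′g
                                    (subst (GCD m k) (sym (*-identityˡ (gcd m k))) (gcd-GCD m k))))
    where
    g≢0 : NonZero (gcd m k)
    g≢0 = ≢-nonZero (gcd[m,n]≢0 m k (inj₁ (≢-nonZero⁻¹ m)))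

  cofactor≡1⇒∣ : ∀ {m′ g} k′ → m′ ≡ 1 → m′ * g ∣ k′ * g
  cofactor≡1⇒∣ {g = g} k′ refl = *-monoˡ-∣ g (1∣ k′)

  ∣-square⇒∣ : ∀ m k → .{{NonZero m}} → m * m ∣ k * k → m ∣ k
  ∣-square⇒∣ m k m²∣k² with gcd-cofactors m k
  ... | m′ , k′ , g , g≢0 , refl , refl , coprime = cofactor≡1⇒∣ k′ (coprime (∣-refl , m′∣k′))
    where
    m′²∣k′² : m′ * m′ ∣ k′ * k′
    m′²∣k′² = *-cancelʳ-∣ (g * g) {{m*n≢0 g g {{g≢0}} {{g≢0}}}}
      (subst₂ _∣_ ([m*n]*[o*p]≡[m*o]*[n*p] m′ g m′ g) ([m*n]*[o*p]≡[m*o]*[n*p] k′ g k′ g) m²∣k²)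
    m′∣k′ : m′ ∣ k′
    m′∣k′ = coprime-divisor coprime (∣-trans (m∣m*n m′) m′²∣k′²)

  squarefree⇒nonZero : ∀ {n} → SquareFree n → NonZero n
  squarefree⇒nonZero {zero} sqf with sqf 0 (divides 0 refl)
  ... | ()
  squarefree⇒nonZero {suc n} sqf = _

  squarefree-∣-square : ∀ n k → SquareFree n → n ∣ k * k → n ∣ k
  squarefree-∣-square n k sqf n∣k² with gcd-cofactors n k {{squarefree⇒nonZero sqf}}
  ... | n′ , k′ , g , g≢0 , refl , refl , coprime = cofactor≡1⇒∣ k′ (sqf n′ n′²∣n)
    where
    n′∣g : n′ ∣ g
    n′∣g = coprime-divisor coprime (coprime-divisor coprime (*-cancelʳ-∣ g {{g≢0}}
      (subst (n′ * g ∣_) (regroup k′ g) n∣k²)))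
      where
      regroup : ∀ a b → (a * b) * (a * b) ≡ (a * (a * b)) * b
      regroup a b = trans (*-assoc a b (a * b)) (trans (cong (a *_) (*-comm b (a * b))) (sym (*-assoc a (a * b) b)))
    n′²∣n : n′ * n′ ∣ n′ * g
    n′²∣n = *-monoʳ-∣ n′ n′∣g

  squarefree*square≡square⇒≡1 : ∀ {n} m k → .{{NonZero m}} → SquareFree n → n * (m * m) ≡ k * k → n ≡ 1
  squarefree*square≡square⇒≡1 {n} m k sqf n·m²≡k² with ∣-square⇒∣ m k (divides n (sym n·m²≡k²))
  ... | divides-refl t = trans n≡t² (cong (λ s → s * s) (sqf t (divides 1 (trans n≡t² (sym (*-identityˡ (t * t)))))))
    where
    n≡t² : n ≡ t * t
    n≡t² = *-cancelʳ-≡ n (t * t) (m * m) {{m*n≢0 m m}} (trans n·m²≡k² ([m*n]*[o*p]≡[m*o]*[n*p] t m t m))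

  sum-of-squares≡1 : ∀ a b c → a * a + b * b + c * c ≡ 1 →
    (a ≡ 1 × b ≡ 0 × c ≡ 0) ⊎ (a ≡ 0 × b ≡ 1 × c ≡ 0) ⊎ (a ≡ 0 × b ≡ 0 × c ≡ 1)
  sum-of-squares≡1 1 0 0 _ = inj₁ (refl , refl , refl)
  sum-of-squares≡1 0 1 0 _ = inj₂ (inj₁ (refl , refl , refl))
  sum-of-squares≡1 0 0 1 _ = inj₂ (inj₂ (refl , refl , refl))
  sum-of-squares≡1 0 0 0 ()
  sum-of-squares≡1 0 0 (suc (suc _)) ()
  sum-of-squares≡1 0 1 (suc _) ()
  sum-of-squares≡1 0 (suc (suc _)) _ ()
  sum-of-squares≡1 1 0 (suc _) ()
  sum-of-squares≡1 1 (suc _) _ ()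
  sum-of-squares≡1 (suc (suc _)) _ _ ()


open Squares
open import Data.Empty using (⊥; ⊥-elim)
open import Data.Integer as ℤ using (ℤ; +_; -[1+_]; +[1+_]; -_; 0ℤ; 1ℤ; _+_; _*_; _-_; ∣_∣)
open import Data.Integer.Divisibility.Signed
  using (_∣_; divides; quotient; module _∣_; ∣-reflexive; ∣ᵤ⇒∣; ∣⇒∣ᵤ; ∣m⇒∣m*n; ∣n⇒∣m*n; ∣m∣n⇒∣m+n; ∣m∣n⇒∣m-n)
open import Data.Integer.GCD using (gcd)
import Data.Integer.Properties as ℤP
open import Data.Integer.Tactic.RingSolver using (solve-∀)
open import Data.List using (List; []; _∷_; map; length)
open import Data.List.Membership.Propositional using (_∈_)
open import Data.List.Membership.Propositional.Properties using (∈-map⁺; ∈-map⁻)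
open import Data.List.Relation.Unary.All using ([]; _∷_)
open import Data.List.Relation.Unary.AllPairs using ([]; _∷_)
open import Data.List.Relation.Unary.Any using (here; there)
open import Data.List.Relation.Unary.Unique.Propositional using (Unique)
import Data.List.Relation.Unary.Unique.Propositional.Properties as Unique
open import Data.Nat as ℕ using (ℕ; zero; suc)
import Data.Nat.Divisibility as ℕᵈ
open import Data.Nat.GCD using (module Bézout; gcd-GCD)
import Data.Nat.Properties as ℕP
import Data.Product as Product
open import Data.Product using (_×_; _,_; ∃; ∃₂; proj₁; proj₂)
open import Data.Sum using (_⊎_; inj₁; inj₂; [_,_]′)
open import Function using (id)
open import Function.Bundles using (_⇔_; mk⇔; module Equivalence)
open import Relation.Binary.PropositionalEquality
open import Relation.Nullary using (¬_)

open ≡-Reasoning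

cong₃ : ∀ {A B C D : Set} (f : A → B → C → D) {a a′ b b′ c c′} → a ≡ a′ → b ≡ b′ → c ≡ c′ → f a b c ≡ f a′ b′ c′
cong₃ f refl refl refl = refl

-- The vector operations transcribed, with the same bracketing, into the expression syntax of the
-- ring solver, so that their semantics unfold definitionally to the operations on V3. Given
-- integers is and vectors vs, ring and ring³ prove an identity stated as a function of as many
-- symbolic integers and vectors.
module VectorRing where

  open import Data.Fin as Fin using (Fin; _↑ˡ_; _↑ʳ_)
  import Data.Integer.Tactic.RingSolver as ℤ-RingSolver
  open import Data.Vec as Vec using (Vec; tabulate)
  open import Tactic.RingSolver.Core.Expression public using (Expr) renaming (Κ to con; _⊕_ to _:+_; _⊗_ to _:*_; ⊝_ to :-_)
  open import Tactic.RingSolver.Core.Expression using () renaming (Ι to var)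
  open import Tactic.RingSolver.NonReflective ℤ-RingSolver.ring using (module Ops)
  open Ops using (prove; ⟦_⟧; ⟦_⇓⟧)

  Polynomial : ℕ → Set
  Polynomial = Expr ℤ

  infixl 6 _:-_

  _:-_ : ∀ {n} → Polynomial n → Polynomial n → Polynomial n
  p :- q = p :+ :- q

  record V3ᴾ (n : ℕ) : Set where
    constructor ⟨_,_,_⟩
    field
      x₁ᴾ x₂ᴾ x₃ᴾ : Polynomial n
  open V3ᴾ public

  infix 4 _:=_

  _:=_ : ∀ {A : Set} → A → A → A × A
  _:=_ = _,_

  module _ {n : ℕ} where

    infixl 6 _⊕ᴾ_ _⊖ᴾ_
    infixl 7 _·ᴾ_

    dotᴾ : V3ᴾ n → V3ᴾ n → Polynomial n
    dotᴾ ⟨ a₁ , a₂ , a₃ ⟩ ⟨ b₁ , b₂ , b₃ ⟩ = a₁ :* b₁ :+ a₂ :* b₂ :+ a₃ :* b₃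

    normᴾ : V3ᴾ n → Polynomial n
    normᴾ a = dotᴾ a a

    crossᴾ : V3ᴾ n → V3ᴾ n → V3ᴾ n
    crossᴾ ⟨ a₁ , a₂ , a₃ ⟩ ⟨ b₁ , b₂ , b₃ ⟩ = ⟨ a₂ :* b₃ :- a₃ :* b₂ , a₃ :* b₁ :- a₁ :* b₃ , a₁ :* b₂ :- a₂ :* b₁ ⟩

    detᴾ : V3ᴾ n → V3ᴾ n → V3ᴾ n → Polynomial n
    detᴾ a b c = dotᴾ (crossᴾ a b) c

    symmetricDetᴾ : (g₁₁ g₁₂ g₁₃ g₂₂ g₂₃ g₃₃ : Polynomial n) → Polynomial n
    symmetricDetᴾ g₁₁ g₁₂ g₁₃ g₂₂ g₂₃ g₃₃ = detᴾ ⟨ g₁₁ , g₁₂ , g₁₃ ⟩ ⟨ g₁₂ , g₂₂ , g₂₃ ⟩ ⟨ g₁₃ , g₂₃ , g₃₃ ⟩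

    _·ᴾ_ : Polynomial n → V3ᴾ n → V3ᴾ n
    k ·ᴾ ⟨ a₁ , a₂ , a₃ ⟩ = ⟨ k :* a₁ , k :* a₂ , k :* a₃ ⟩

    _⊕ᴾ_ : V3ᴾ n → V3ᴾ n → V3ᴾ n
    ⟨ a₁ , a₂ , a₃ ⟩ ⊕ᴾ ⟨ b₁ , b₂ , b₃ ⟩ = ⟨ a₁ :+ b₁ , a₂ :+ b₂ , a₃ :+ b₃ ⟩

    negᴾ : V3ᴾ n → V3ᴾ n
    negᴾ a = con (- 1ℤ) ·ᴾ a

    _⊖ᴾ_ : V3ᴾ n → V3ᴾ n → V3ᴾ n
    a ⊖ᴾ b = a ⊕ᴾ negᴾ b

    combineᴾ : V3ᴾ n → V3ᴾ n → V3ᴾ n → V3ᴾ n → V3ᴾ n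
    combineᴾ u v w p = x₁ᴾ p ·ᴾ u ⊕ᴾ x₂ᴾ p ·ᴾ v ⊕ᴾ x₃ᴾ p ·ᴾ w

    rotateᴾ : V3ᴾ n → V3ᴾ n
    rotateᴾ ⟨ a₁ , a₂ , a₃ ⟩ = ⟨ a₂ , a₃ , a₁ ⟩

  private
    Curried : ℕ → Set → Set → Set
    Curried zero    A B = B
    Curried (suc k) A B = A → Curried k A B

    apply : ∀ k {A B} → Curried k A B → Vec A k → B
    apply zero    f Vec.[]         = f
    apply (suc k) f (x Vec.∷ xs) = apply k (f x) xs

    Size : List ℤ → List V3 → ℕ
    Size is vs = length is ℕ.+ length vs ℕ.* 3

    env : ∀ is vs → Vec ℤ (Size is vs)
    env (i ∷ is) vs       = i Vec.∷ env is vs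
    env []       []       = Vec.[]
    env []       (v ∷ vs) = x₁ v Vec.∷ x₂ v Vec.∷ x₃ v Vec.∷ env [] vs

    Identity : List ℤ → List V3 → Set → Set
    Identity is vs B = Curried (length is) (Polynomial (Size is vs)) (Curried (length vs) (V3ᴾ (Size is vs)) (B × B))

    sides : ∀ is vs {B} → Identity is vs B → B × B
    sides is vs {B} f = apply (length vs) {V3ᴾ (Size is vs)} {B × B}
      (apply (length is) {Polynomial (Size is vs)} f (tabulate (λ i → var (i ↑ˡ length vs ℕ.* 3))))
      (tabulate (λ i → ⟨ coordinate i Fin.zero , coordinate i (Fin.suc Fin.zero) , coordinate i (Fin.suc (Fin.suc Fin.zero)) ⟩))
      where
      coordinate : Fin (length vs) → Fin 3 → Polynomial (Size is vs)
      coordinate i j = var (length is ↑ʳ Fin.combine i j)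

  ring : ∀ is vs (f : Identity is vs (Polynomial (Size is vs))) →
         ⟦ proj₁ (sides is vs f) ⇓⟧ (env is vs) ≡ ⟦ proj₂ (sides is vs f) ⇓⟧ (env is vs) →
         ⟦ proj₁ (sides is vs f) ⟧ (env is vs) ≡ ⟦ proj₂ (sides is vs f) ⟧ (env is vs)
  ring is vs f = prove (env is vs) (proj₁ (sides is vs f)) (proj₂ (sides is vs f))

  ring³ : ∀ is vs (f : Identity is vs (V3ᴾ (Size is vs))) → let l , r = sides is vs f; ρ = env is vs in
          ⟦ x₁ᴾ l ⇓⟧ ρ ≡ ⟦ x₁ᴾ r ⇓⟧ ρ → ⟦ x₂ᴾ l ⇓⟧ ρ ≡ ⟦ x₂ᴾ r ⇓⟧ ρ → ⟦ x₃ᴾ l ⇓⟧ ρ ≡ ⟦ x₃ᴾ r ⇓⟧ ρ →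
          mkV (⟦ x₁ᴾ l ⟧ ρ) (⟦ x₂ᴾ l ⟧ ρ) (⟦ x₃ᴾ l ⟧ ρ) ≡ mkV (⟦ x₁ᴾ r ⟧ ρ) (⟦ x₂ᴾ r ⟧ ρ) (⟦ x₃ᴾ r ⟧ ρ)
  ring³ is vs f e₁ e₂ e₃ = cong₃ mkV (component x₁ᴾ e₁) (component x₂ᴾ e₂) (component x₃ᴾ e₃)
    where
    component : ∀ (xᵢ : V3ᴾ (Size is vs) → Polynomial (Size is vs)) →
                ⟦ xᵢ (proj₁ (sides is vs f)) ⇓⟧ (env is vs) ≡ ⟦ xᵢ (proj₂ (sides is vs f)) ⇓⟧ (env is vs) →
                ⟦ xᵢ (proj₁ (sides is vs f)) ⟧ (env is vs) ≡ ⟦ xᵢ (proj₂ (sides is vs f)) ⟧ (env is vs)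
    component xᵢ = prove (env is vs) (xᵢ (proj₁ (sides is vs f))) (xᵢ (proj₂ (sides is vs f)))

open VectorRing

-- Vector algebra in ℤ³

cross : V3 → V3 → V3
cross (mkV a₁ a₂ a₃) (mkV b₁ b₂ b₃) = mkV (a₂ * b₃ - a₃ * b₂) (a₃ * b₁ - a₁ * b₃) (a₁ * b₂ - a₂ * b₁)

det : V3 → V3 → V3 → ℤ
det a b c = dot (cross a b) c

symmetricDet : ℤ → ℤ → ℤ → ℤ → ℤ → ℤ → ℤ
symmetricDet g₁₁ g₁₂ g₁₃ g₂₂ g₂₃ g₃₃ = det (mkV g₁₁ g₁₂ g₁₃) (mkV g₁₂ g₂₂ g₂₃) (mkV g₁₃ g₂₃ g₃₃)

gram : V3 → V3 → V3 → ℤ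
gram a b c = symmetricDet (norm a) (dot a b) (dot a c) (norm b) (dot b c) (norm c)

dot-comm : ∀ a b → dot a b ≡ dot b a
dot-comm a b = ring [] (a ∷ b ∷ []) (λ a b → dotᴾ a b := dotᴾ b a) refl

dot-cross-self : ∀ a b → dot a (cross a b) ≡ 0ℤ
dot-cross-self a b = ring [] (a ∷ b ∷ []) (λ a b → dotᴾ a (crossᴾ a b) := con 0ℤ) refl

lagrange : ∀ a b → norm (cross a b) ≡ norm a * norm b - dot a b * dot a b
lagrange a b = ring [] (a ∷ b ∷ []) (λ a b → normᴾ (crossᴾ a b) := normᴾ a :* normᴾ b :- dotᴾ a b :* dotᴾ a b) refl

cross-cross : ∀ a b → cross (cross a b) a ≡ norm a · b ⊖ dot b a · a
cross-cross a b =
  ring³ [] (a ∷ b ∷ []) (λ a b → crossᴾ (crossᴾ a b) a := normᴾ a ·ᴾ b ⊖ᴾ dotᴾ b a ·ᴾ a) refl refl refl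

dot-cross-cross : ∀ a b c → dot (cross (cross a b) a) c ≡ norm a * dot b c - dot b a * dot a c
dot-cross-cross a b c =
  ring [] (a ∷ b ∷ c ∷ []) (λ a b c → dotᴾ (crossᴾ (crossᴾ a b) a) c := normᴾ a :* dotᴾ b c :- dotᴾ b a :* dotᴾ a c) refl

cross-scaleˡ : ∀ k a b → cross (k · a) b ≡ k · cross a b
cross-scaleˡ k a b = ring³ (k ∷ []) (a ∷ b ∷ []) (λ k a b → crossᴾ (k ·ᴾ a) b := k ·ᴾ crossᴾ a b) refl refl refl

dot-scaleʳ : ∀ k a b → dot a (k · b) ≡ k * dot a b
dot-scaleʳ k a b = ring (k ∷ []) (a ∷ b ∷ []) (λ k a b → dotᴾ a (k ·ᴾ b) := k :* dotᴾ a b) refl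

norm-scale : ∀ k a → norm (k · a) ≡ k * k * norm a
norm-scale k a = ring (k ∷ []) (a ∷ []) (λ k a → normᴾ (k ·ᴾ a) := k :* k :* normᴾ a) refl

cramer : ∀ a b c d → det a b c · d ≡ dot a d · cross b c ⊕ dot b d · cross c a ⊕ dot c d · cross a b
cramer a b c d = ring³ [] (a ∷ b ∷ c ∷ d ∷ []) (λ a b c d →
  detᴾ a b c ·ᴾ d := dotᴾ a d ·ᴾ crossᴾ b c ⊕ᴾ dotᴾ b d ·ᴾ crossᴾ c a ⊕ᴾ dotᴾ c d ·ᴾ crossᴾ a b) refl refl refl

cramer-dot : ∀ a b c d e → det a b c * dot d e ≡ dot d a * dot (cross b c) e + dot d b * dot (cross c a) e + dot d c * dot (cross a b) e
cramer-dot a b c d e = ring [] (a ∷ b ∷ c ∷ d ∷ e ∷ []) (λ a b c d e →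
  detᴾ a b c :* dotᴾ d e := dotᴾ d a :* dotᴾ (crossᴾ b c) e :+ dotᴾ d b :* dotᴾ (crossᴾ c a) e :+ dotᴾ d c :* dotᴾ (crossᴾ a b) e) refl

det²≡gram : ∀ a b c → det a b c * det a b c ≡ gram a b c
det²≡gram a b c = ring [] (a ∷ b ∷ c ∷ []) (λ a b c →
  detᴾ a b c :* detᴾ a b c := symmetricDetᴾ (normᴾ a) (dotᴾ a b) (dotᴾ a c) (normᴾ b) (dotᴾ b c) (normᴾ c)) refl

·-cancelˡ : ∀ {k a b} → k ≢ 0ℤ → k · a ≡ k · b → a ≡ b
·-cancelˡ {k} {mkV a₁ a₂ a₃} {mkV b₁ b₂ b₃} k≢0 ka≡kb =
  cong₃ mkV (cancel (cong x₁ ka≡kb)) (cancel (cong x₂ ka≡kb)) (cancel (cong x₃ ka≡kb))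
  where
  cancel : ∀ {i j} → k * i ≡ k * j → i ≡ j
  cancel {i} {j} = ℤP.*-cancelˡ-≡ k i j {{ℤ.≢-nonZero k≢0}}

*-≢0 : ∀ {i j} → i ≢ 0ℤ → j ≢ 0ℤ → i * j ≢ 0ℤ
*-≢0 {i} i≢0 j≢0 ij≡0 = [ i≢0 , j≢0 ]′ (ℤP.i*j≡0⇒i≡0∨j≡0 i ij≡0)

dot-injective : ∀ a b c {y y′} → det a b c ≢ 0ℤ →
                dot a y ≡ dot a y′ → dot b y ≡ dot b y′ → dot c y ≡ dot c y′ → y ≡ y′
dot-injective a b c {y} {y′} det≢0 ay≡ay′ by≡by′ cy≡cy′ = ·-cancelˡ det≢0 (begin
  det a b c · y                                                      ≡⟨ cramer a b c y ⟩
  dot a y · cross b c ⊕ dot b y · cross c a ⊕ dot c y · cross a b    ≡⟨ cong₂ _⊕_ (cong₂ _⊕_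
                                                                          (cong (_· cross b c) ay≡ay′) (cong (_· cross c a) by≡by′))
                                                                          (cong (_· cross a b) cy≡cy′) ⟩
  dot a y′ · cross b c ⊕ dot b y′ · cross c a ⊕ dot c y′ · cross a b ≡⟨ cramer a b c y′ ⟨
  det a b c · y′                                                     ∎)

-- Divisibility and Bézout's identity in ℤ

square≡+∣∣² : ∀ i → i * i ≡ + (∣ i ∣ ℕ.* ∣ i ∣)
square≡+∣∣² (+ n) = ℤP.+◃n≡+n (n ℕ.* n)
square≡+∣∣² -[1+ n ] = refl

∣-square⇒∣ᶻ : ∀ {i j} → .{{ℤ.NonZero i}} → i * i ∣ j * j → i ∣ j
∣-square⇒∣ᶻ {i} {j} i²∣j² =
  ∣ᵤ⇒∣ (∣-square⇒∣ ∣ i ∣ ∣ j ∣ (subst₂ ℕᵈ._∣_ (ℤP.abs-* i i) (ℤP.abs-* j j) (∣⇒∣ᵤ i²∣j²)))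

squarefree-∣-squareᶻ : ∀ {n j} → SquareFree n → + n ∣ j * j → + n ∣ j
squarefree-∣-squareᶻ {n} {j} sqf n∣j² =
  ∣ᵤ⇒∣ (squarefree-∣-square n ∣ j ∣ sqf (subst (n ℕᵈ.∣_) (ℤP.abs-* j j) (∣⇒∣ᵤ n∣j²)))

*-pres-∣ : ∀ {i j m n} → i ∣ m → j ∣ n → i * j ∣ m * n
*-pres-∣ {i} {j} (divides a refl) (divides b refl) = divides (a * b) (rearrange a b i j)
  where
  rearrange : ∀ a b i j → a * i * (b * j) ≡ a * b * (i * j)
  rearrange = solve-∀

∣-cancel-unit : ∀ {i m n k} → i ∣ m → i ∣ (m * n - 1ℤ) * k → i ∣ k
∣-cancel-unit {i} {m} {n} {k} i∣m i∣[mn-1]k =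
  subst (i ∣_) (cancel m n k) (∣m∣n⇒∣m-n (∣m⇒∣m*n k (∣m⇒∣m*n n i∣m)) i∣[mn-1]k)
  where
  cancel : ∀ m n k → m * n * k - (m * n - 1ℤ) * k ≡ k
  cancel = solve-∀

+∣∣≡±i : ∀ i → ∃ λ σ → + ∣ i ∣ ≡ σ * i
+∣∣≡±i i with ℤP.+∣i∣≡i⊎+∣i∣≡-i i
... | inj₁ +∣i∣≡i  = 1ℤ , trans +∣i∣≡i (sym (ℤP.*-identityˡ i))
... | inj₂ +∣i∣≡-i = - 1ℤ , trans +∣i∣≡-i (sym (ℤP.-1*i≡-i i))

pos-difference : ∀ {d} y b x a → d ℕ.+ y ℕ.* b ≡ x ℕ.* a → + x * + a - + y * + b ≡ + d
pos-difference {d} y b x a d+yb≡xa = begin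
  + x * + a - + y * + b           ≡⟨ cong₂ _-_ (ℤP.pos-* x a) (ℤP.pos-* y b) ⟨
  + (x ℕ.* a) - + (y ℕ.* b)       ≡⟨ cong (λ t → + t - + (y ℕ.* b)) d+yb≡xa ⟨
  + (d ℕ.+ y ℕ.* b) - + (y ℕ.* b) ≡⟨ cong (_- + (y ℕ.* b)) (ℤP.pos-+ d (y ℕ.* b)) ⟩
  + d + + (y ℕ.* b) - + (y ℕ.* b) ≡⟨ +-cancelʳ (+ d) (+ (y ℕ.* b)) ⟩
  + d                             ∎
  where
  +-cancelʳ : ∀ i j → i + j - j ≡ i
  +-cancelʳ = solve-∀

abs-combination : ∀ {g} i j x y → x * + ∣ i ∣ - y * + ∣ j ∣ ≡ g → ∃₂ λ r s → r * i + s * j ≡ g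
abs-combination i j x y x∣i∣-y∣j∣≡g with +∣∣≡±i i | +∣∣≡±i j
... | σ , ∣i∣≡σi | τ , ∣j∣≡τj = x * σ , - (y * τ) , (begin
  x * σ * i + - (y * τ) * j ≡⟨ regroup x σ i y τ j ⟩
  x * (σ * i) - y * (τ * j) ≡⟨ cong₂ (λ a b → x * a - y * b) ∣i∣≡σi ∣j∣≡τj ⟨
  x * + ∣ i ∣ - y * + ∣ j ∣ ≡⟨ x∣i∣-y∣j∣≡g ⟩
  _                         ∎)
  where
  regroup : ∀ x σ i y τ j → x * σ * i + - (y * τ) * j ≡ x * (σ * i) - y * (τ * j)
  regroup = solve-∀

bézout : ∀ i j → ∃₂ λ r s → r * i + s * j ≡ gcd i j
bézout i j with Bézout.identity (gcd-GCD ∣ i ∣ ∣ j ∣)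
... | Bézout.+- x y d+y∣j∣≡x∣i∣ = abs-combination i j (+ x) (+ y) (pos-difference y (∣ j ∣) x (∣ i ∣) d+y∣j∣≡x∣i∣)
... | Bézout.-+ x y d+x∣i∣≡y∣j∣ with abs-combination j i (+ y) (+ x) (pos-difference x (∣ i ∣) y (∣ j ∣) d+x∣i∣≡y∣j∣)
...   | s , r , sj+ri≡g = r , s , trans (ℤP.+-comm (r * i) (s * j)) sj+ri≡g

primitive⇒dual : ∀ x → Primitive x → ∃ λ e → dot x e ≡ 1ℤ
primitive⇒dual (mkV a b c) gcd≡1 with bézout a b
... | r , s , ra+sb≡g with bézout (gcd a b) c
... | r′ , s′ , r′g+s′c≡1 = mkV (r′ * r) (r′ * s) s′ , (begin
  a * (r′ * r) + b * (r′ * s) + c * s′ ≡⟨ regroup a b c r s r′ s′ ⟩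
  r′ * (r * a + s * b) + s′ * c        ≡⟨ cong (λ g → r′ * g + s′ * c) ra+sb≡g ⟩
  r′ * gcd a b + s′ * c                ≡⟨ r′g+s′c≡1 ⟩
  gcd (gcd a b) c                      ≡⟨ gcd≡1 ⟩
  1ℤ                                   ∎)
  where
  regroup : ∀ a b c r s r′ s′ → a * (r′ * r) + b * (r′ * s) + c * s′ ≡ r′ * (r * a + s * b) + s′ * c
  regroup = solve-∀

∣-symmetricDet : ∀ {i g₁₁ g₁₃ g₂₂ g₂₃ g₃₃} → i ∣ g₁₁ → i ∣ g₁₃ → i ∣ g₃₃ →
                 i ∣ symmetricDet g₁₁ 1ℤ g₁₃ g₂₂ g₂₃ g₃₃
∣-symmetricDet {i} {g₁₁} {g₁₃} {g₂₂} {g₂₃} {g₃₃} i∣g₁₁ i∣g₁₃ i∣g₃₃ = subst (i ∣_) (sym expansion)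
  (∣m∣n⇒∣m+n (∣m∣n⇒∣m-n (∣m⇒∣m*n _ i∣g₁₁) (∣m∣n⇒∣m-n i∣g₃₃ (∣n⇒∣m*n g₂₃ i∣g₁₃))) (∣m⇒∣m*n _ i∣g₁₃))
  where
  expansion : symmetricDet g₁₁ 1ℤ g₁₃ g₂₂ g₂₃ g₃₃ ≡
              g₁₁ * (g₂₂ * g₃₃ - g₂₃ * g₂₃) - (g₃₃ - g₂₃ * g₁₃) + g₁₃ * (g₂₃ - g₂₂ * g₁₃)
  expansion = ring (g₁₁ ∷ g₁₃ ∷ g₂₂ ∷ g₂₃ ∷ g₃₃ ∷ []) [] (λ g₁₁ g₁₃ g₂₂ g₂₃ g₃₃ →
    symmetricDetᴾ g₁₁ (con 1ℤ) g₁₃ g₂₂ g₂₃ g₃₃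
      := g₁₁ :* (g₂₂ :* g₃₃ :- g₂₃ :* g₂₃) :- (g₃₃ :- g₂₃ :* g₁₃) :+ g₁₃ :* (g₂₃ :- g₂₂ :* g₁₃)) refl

module _ (μ : ℤ) .{{_ : ℤ.NonZero μ}} (x e : V3) (x·e≡1 : dot x e ≡ 1ℤ) (μ²∣x² : μ * μ ∣ norm x) where

  ∣-dot-cross : ∀ y → μ * μ ∣ dot x y → μ * μ ∣ norm y → μ ∣ dot (cross x e) y
  ∣-dot-cross y μ²∣xy μ²∣y² = ∣-square⇒∣ᶻ (subst (μ * μ ∣_) (sym (det²≡gram x e y)) μ²∣gram)
    where
    μ²∣gram : μ * μ ∣ gram x e y
    μ²∣gram = subst (λ g → μ * μ ∣ symmetricDet (norm x) g (dot x y) (norm e) (dot e y) (norm y))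
                    (sym x·e≡1) (∣-symmetricDet {g₂₂ = norm e} {dot e y} μ²∣x² μ²∣xy μ²∣y²)

  ∣-dot : ∀ y z → μ * μ ∣ dot x y → μ * μ ∣ norm y → μ * μ ∣ dot x z → μ * μ ∣ norm z → μ * μ ∣ dot y z
  ∣-dot y z μ²∣xy μ²∣y² μ²∣xz μ²∣z² =
    ∣-cancel-unit μ²∣x² (subst (μ * μ ∣_) (sym expansion) μ²∣expansion)
    where
    f = cross x e
    expansion : (norm x * norm e - 1ℤ) * dot y z ≡
                dot y x * dot (cross e f) z + dot y e * dot (cross f x) z + dot y f * dot f z
    expansion = begin
      (norm x * norm e - 1ℤ) * dot y z                ≡⟨ cong (λ t → (norm x * norm e - t * t) * dot y z) x·e≡1 ⟨
      (norm x * norm e - dot x e * dot x e) * dot y z ≡⟨ cong (_* dot y z) (lagrange x e) ⟨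
      det x e f * dot y z                             ≡⟨ cramer-dot x e f y z ⟩
      dot y x * dot (cross e f) z + dot y e * dot (cross f x) z + dot y f * dot f z ∎
    μ²∣fxz : μ * μ ∣ dot (cross f x) z
    μ²∣fxz = subst (μ * μ ∣_) (sym (dot-cross-cross x e z))
      (∣m∣n⇒∣m-n (∣m⇒∣m*n (dot e z) μ²∣x²) (∣n⇒∣m*n (dot e x) μ²∣xz))
    μ²∣expansion : μ * μ ∣ dot y x * dot (cross e f) z + dot y e * dot (cross f x) z + dot y f * dot f z
    μ²∣expansion = ∣m∣n⇒∣m+n
      (∣m∣n⇒∣m+n (∣m⇒∣m*n (dot (cross e f) z) (subst (μ * μ ∣_) (dot-comm x y) μ²∣xy)) (∣n⇒∣m*n (dot y e) μ²∣fxz))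
      (*-pres-∣ (subst (μ ∣_) (dot-comm f y) (∣-dot-cross y μ²∣xy μ²∣y²)) (∣-dot-cross z μ²∣xz μ²∣z²))

-- Twins and the cubic lattice of an icube

record IsOrthogonalFrame (M : ℤ) (u v w : V3) : Set where
  field
    u⊥v : dot u v ≡ 0ℤ
    v⊥w : dot v w ≡ 0ℤ
    w⊥u : dot w u ≡ 0ℤ
    u²≡M : norm u ≡ M
    v²≡M : norm v ≡ M
    w²≡M : norm w ≡ M

icube⇒frame : ∀ {M u v w} → IsIcube u v w → norm u ≡ M → IsOrthogonalFrame M u v w
icube⇒frame {u = u} {w = w} (_ , _ , _ , u⊥v , u⊥w , v⊥w , u²≡v² , v²≡w²) u²≡M = record
  { u⊥v = u⊥v ; v⊥w = v⊥w ; w⊥u = trans (dot-comm w u) u⊥w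
  ; u²≡M = u²≡M ; v²≡M = trans (sym u²≡v²) u²≡M ; w²≡M = trans (sym v²≡w²) (trans (sym u²≡v²) u²≡M) }

frame-rotate : ∀ {M u v w} → IsOrthogonalFrame M u v w → IsOrthogonalFrame M v w u
frame-rotate frame = record { u⊥v = v⊥w ; v⊥w = w⊥u ; w⊥u = u⊥v ; u²≡M = v²≡M ; v²≡M = w²≡M ; w²≡M = u²≡M }
  where open IsOrthogonalFrame frame

frame-swap : ∀ {M u v w} → IsOrthogonalFrame M u v w → IsOrthogonalFrame M u w v
frame-swap {u = u} {v} {w} frame = record
  { u⊥v = trans (dot-comm u w) w⊥u ; v⊥w = trans (dot-comm w v) v⊥w ; w⊥u = trans (dot-comm v u) u⊥v
  ; u²≡M = u²≡M ; v²≡M = w²≡M ; w²≡M = v²≡M }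
  where open IsOrthogonalFrame frame

combine : V3 → V3 → V3 → V3 → V3
combine u v w p = x₁ p · u ⊕ x₂ p · v ⊕ x₃ p · w

dot-combineʳ : ∀ a u v w p → dot a (combine u v w p) ≡ x₁ p * dot a u + x₂ p * dot a v + x₃ p * dot a w
dot-combineʳ a u v w p = ring [] (a ∷ u ∷ v ∷ w ∷ p ∷ []) (λ a u v w p →
  dotᴾ a (combineᴾ u v w p) := x₁ᴾ p :* dotᴾ a u :+ x₂ᴾ p :* dotᴾ a v :+ x₃ᴾ p :* dotᴾ a w) refl

module Lattice {u v w : V3} {μ : ℤ} (frame : IsOrthogonalFrame (μ * μ) u v w) (μ≢0 : μ ≢ 0ℤ) where

  open IsOrthogonalFrame frame

  private
    instance
      μ-nonZero : ℤ.NonZero μ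
      μ-nonZero = ℤ.≢-nonZero μ≢0
      μ²-nonZero : ℤ.NonZero (μ * μ)
      μ²-nonZero = ℤP.i*j≢0 μ μ

    u⊥w : dot u w ≡ 0ℤ
    u⊥w = trans (dot-comm u w) w⊥u
    v⊥u : dot v u ≡ 0ℤ
    v⊥u = trans (dot-comm v u) u⊥v
    w⊥v : dot w v ≡ 0ℤ
    w⊥v = trans (dot-comm w v) v⊥w

  ⟦_⟧ : V3 → V3
  ⟦ p ⟧ = combine u v w p

  dot-⟦⟧-expand : ∀ a {A B C} p → dot a u ≡ A → dot a v ≡ B → dot a w ≡ C →
                  dot a ⟦ p ⟧ ≡ x₁ p * A + x₂ p * B + x₃ p * C
  dot-⟦⟧-expand a p refl refl refl = dot-combineʳ a u v w p

  private
    only-x₁ : ∀ a b c M → a * M + b * 0ℤ + c * 0ℤ ≡ a * M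
    only-x₁ = solve-∀
    only-x₂ : ∀ a b c M → a * 0ℤ + b * M + c * 0ℤ ≡ b * M
    only-x₂ = solve-∀
    only-x₃ : ∀ a b c M → a * 0ℤ + b * 0ℤ + c * M ≡ c * M
    only-x₃ = solve-∀

  dot-u⟦⟧ : ∀ p → dot u ⟦ p ⟧ ≡ x₁ p * (μ * μ)
  dot-u⟦⟧ p@(mkV p₁ p₂ p₃) = begin
    dot u ⟦ p ⟧                       ≡⟨ dot-⟦⟧-expand u p u²≡M u⊥v u⊥w ⟩
    p₁ * (μ * μ) + p₂ * 0ℤ + p₃ * 0ℤ ≡⟨ only-x₁ p₁ p₂ p₃ (μ * μ) ⟩
    p₁ * (μ * μ)                      ∎

  dot-v⟦⟧ : ∀ p → dot v ⟦ p ⟧ ≡ x₂ p * (μ * μ)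
  dot-v⟦⟧ p@(mkV p₁ p₂ p₃) = begin
    dot v ⟦ p ⟧                       ≡⟨ dot-⟦⟧-expand v p v⊥u v²≡M v⊥w ⟩
    p₁ * 0ℤ + p₂ * (μ * μ) + p₃ * 0ℤ ≡⟨ only-x₂ p₁ p₂ p₃ (μ * μ) ⟩
    p₂ * (μ * μ)                      ∎

  dot-w⟦⟧ : ∀ p → dot w ⟦ p ⟧ ≡ x₃ p * (μ * μ)
  dot-w⟦⟧ p@(mkV p₁ p₂ p₃) = begin
    dot w ⟦ p ⟧                       ≡⟨ dot-⟦⟧-expand w p w⊥u w⊥v w²≡M ⟩
    p₁ * 0ℤ + p₂ * 0ℤ + p₃ * (μ * μ) ≡⟨ only-x₃ p₁ p₂ p₃ (μ * μ) ⟩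
    p₃ * (μ * μ)                      ∎

  dot-⟦⟧ : ∀ p q → dot ⟦ p ⟧ ⟦ q ⟧ ≡ dot p q * (μ * μ)
  dot-⟦⟧ p@(mkV p₁ p₂ p₃) q@(mkV q₁ q₂ q₃) = begin
    dot ⟦ p ⟧ ⟦ q ⟧                                                 ≡⟨ dot-⟦⟧-expand ⟦ p ⟧ q (flip u (dot-u⟦⟧ p))
                                                                                             (flip v (dot-v⟦⟧ p)) (flip w (dot-w⟦⟧ p)) ⟩
    q₁ * (p₁ * (μ * μ)) + q₂ * (p₂ * (μ * μ)) + q₃ * (p₃ * (μ * μ)) ≡⟨ factor p₁ p₂ p₃ q₁ q₂ q₃ (μ * μ) ⟩
    dot p q * (μ * μ)                                               ∎
    where
    flip : ∀ {k} z → dot z ⟦ p ⟧ ≡ k → dot ⟦ p ⟧ z ≡ k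
    flip z = trans (dot-comm ⟦ p ⟧ z)
    factor : ∀ p₁ p₂ p₃ q₁ q₂ q₃ M → q₁ * (p₁ * M) + q₂ * (p₂ * M) + q₃ * (p₃ * M) ≡ (p₁ * q₁ + p₂ * q₂ + p₃ * q₃) * M
    factor = solve-∀

  ⟦⟧-injective : ∀ {p q} → ⟦ p ⟧ ≡ ⟦ q ⟧ → p ≡ q
  ⟦⟧-injective {p} {q} ⟦p⟧≡⟦q⟧ = cong₃ mkV
    (ℤP.*-cancelʳ-≡ _ _ (μ * μ) (trans (sym (dot-u⟦⟧ p)) (trans (cong (dot u) ⟦p⟧≡⟦q⟧) (dot-u⟦⟧ q))))
    (ℤP.*-cancelʳ-≡ _ _ (μ * μ) (trans (sym (dot-v⟦⟧ p)) (trans (cong (dot v) ⟦p⟧≡⟦q⟧) (dot-v⟦⟧ q))))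
    (ℤP.*-cancelʳ-≡ _ _ (μ * μ) (trans (sym (dot-w⟦⟧ p)) (trans (cong (dot w) ⟦p⟧≡⟦q⟧) (dot-w⟦⟧ q))))

  det≢0 : det u v w ≢ 0ℤ
  det≢0 det≡0 = *-≢0 (*-≢0 μ²≢0 μ²≢0) μ²≢0 (begin
    μ * μ * (μ * μ) * (μ * μ)                                              ≡⟨ ring (μ ∷ []) [] (λ μ → symmetricDetᴾ (μ :* μ) (con 0ℤ) (con 0ℤ) (μ :* μ) (con 0ℤ) (μ :* μ) := μ :* μ :* (μ :* μ) :* (μ :* μ)) refl ⟨
    symmetricDet (μ * μ) 0ℤ 0ℤ (μ * μ) 0ℤ (μ * μ)                          ≡⟨ cong₃ (λ a b c → symmetricDet a b c (μ * μ) 0ℤ (μ * μ))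
                                                                                      u²≡M u⊥v u⊥w ⟨
    symmetricDet (norm u) (dot u v) (dot u w) (μ * μ) 0ℤ (μ * μ)          ≡⟨ cong₃ (symmetricDet (norm u) (dot u v) (dot u w))
                                                                                      v²≡M v⊥w w²≡M ⟨
    symmetricDet (norm u) (dot u v) (dot u w) (norm v) (dot v w) (norm w) ≡⟨ det²≡gram u v w ⟨
    det u v w * det u v w                                                  ≡⟨ cong (λ d → d * d) det≡0 ⟩
    0ℤ                                                                     ∎)
    where
    μ²≢0 : μ * μ ≢ 0ℤ
    μ²≢0 = *-≢0 μ≢0 μ≢0

  twin-⟦⟧ : ∀ {p q} → Twin ⟦ q ⟧ ⟦ p ⟧ ⇔ Twin q p
  twin-⟦⟧ {p} {q} = mk⇔
    (λ (⟦q⟧⊥⟦p⟧ , ⟦p⟧²≡⟦q⟧²) →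
       ℤP.*-cancelʳ-≡ _ _ (μ * μ) (trans (sym (dot-⟦⟧ q p)) ⟦q⟧⊥⟦p⟧) ,
       ℤP.*-cancelʳ-≡ _ _ (μ * μ) (trans (sym (dot-⟦⟧ p p)) (trans ⟦p⟧²≡⟦q⟧² (dot-⟦⟧ q q))))
    (λ (q⊥p , p²≡q²) →
       trans (dot-⟦⟧ q p) (cong (_* (μ * μ)) q⊥p) ,
       trans (dot-⟦⟧ p p) (trans (cong (_* (μ * μ)) p²≡q²) (sym (dot-⟦⟧ q q))))

  twin-in-lattice : ∀ q e {y} → dot ⟦ q ⟧ e ≡ 1ℤ → Twin ⟦ q ⟧ y → ∃ λ p → y ≡ ⟦ p ⟧
  twin-in-lattice q e {y} x·e≡1 (x⊥y , y²≡x²) =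
    coordinates (μ²∣y· u (μ²∣x· u (divides (x₁ q) (dot-u⟦⟧ q))) (∣-reflexive (sym u²≡M)))
                (μ²∣y· v (μ²∣x· v (divides (x₂ q) (dot-v⟦⟧ q))) (∣-reflexive (sym v²≡M)))
                (μ²∣y· w (μ²∣x· w (divides (x₃ q) (dot-w⟦⟧ q))) (∣-reflexive (sym w²≡M)))
    where
    μ²∣x· : ∀ z → μ * μ ∣ dot z ⟦ q ⟧ → μ * μ ∣ dot ⟦ q ⟧ z
    μ²∣x· z = subst (μ * μ ∣_) (dot-comm z ⟦ q ⟧)
    μ²∣y· : ∀ z → μ * μ ∣ dot ⟦ q ⟧ z → μ * μ ∣ norm z → μ * μ ∣ dot y z
    μ²∣y· z = ∣-dot μ ⟦ q ⟧ e x·e≡1 (divides (norm q) (dot-⟦⟧ q q)) y z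
                (divides 0ℤ x⊥y) (divides (norm q) (trans y²≡x² (dot-⟦⟧ q q)))
    coordinates : μ * μ ∣ dot y u → μ * μ ∣ dot y v → μ * μ ∣ dot y w → ∃ λ p → y ≡ ⟦ p ⟧
    coordinates (divides α y·u≡αμ²) (divides β y·v≡βμ²) (divides γ y·w≡γμ²) = mkV α β γ , dot-injective u v w det≢0
      (trans (dot-comm u y) (trans y·u≡αμ² (sym (dot-u⟦⟧ (mkV α β γ)))))
      (trans (dot-comm v y) (trans y·v≡βμ² (sym (dot-v⟦⟧ (mkV α β γ)))))
      (trans (dot-comm w y) (trans y·w≡γμ² (sym (dot-w⟦⟧ (mkV α β γ)))))

  twin-coordinates : ∀ q {y} → Primitive ⟦ q ⟧ → Twin ⟦ q ⟧ y → ∃ λ p → Twin q p × y ≡ ⟦ p ⟧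
  twin-coordinates q {y} prim twin = via-dual (primitive⇒dual ⟦ q ⟧ prim)
    where
    via-dual : (∃ λ e → dot ⟦ q ⟧ e ≡ 1ℤ) → ∃ λ p → Twin q p × y ≡ ⟦ p ⟧
    via-dual (e , x·e≡1) = Product.map₂
      (λ {p} y≡⟦p⟧ → Equivalence.to (twin-⟦⟧ {p} {q}) (subst (Twin ⟦ q ⟧) y≡⟦p⟧ twin) , y≡⟦p⟧)
      (twin-in-lattice q e x·e≡1 twin)

  twins-⟦⟧ : ∀ q {P} → Primitive ⟦ q ⟧ → (∀ p → Twin q p ⇔ p ∈ P) → Unique P → TwinsAre ⟦ q ⟧ (map ⟦_⟧ P)
  twins-⟦⟧ q {P} prim twin⇔∈P unique = Unique.map⁺ ⟦⟧-injective unique , λ y → mk⇔ (to y) (from y)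
    where
    member : ∀ {y} → (∃ λ p → Twin q p × y ≡ ⟦ p ⟧) → y ∈ map ⟦_⟧ P
    member (p , q-twin , y≡⟦p⟧) =
      subst (_∈ map ⟦_⟧ P) (sym y≡⟦p⟧) (∈-map⁺ ⟦_⟧ (Equivalence.to (twin⇔∈P p) q-twin))
    twin : ∀ {y} → (∃ λ p → p ∈ P × y ≡ ⟦ p ⟧) → Twin ⟦ q ⟧ y
    twin (p , p∈P , y≡⟦p⟧) =
      subst (Twin ⟦ q ⟧) (sym y≡⟦p⟧) (Equivalence.from (twin-⟦⟧ {p} {q}) (Equivalence.from (twin⇔∈P p) p∈P))
    to : ∀ y → Twin ⟦ q ⟧ y → y ∈ map ⟦_⟧ P
    to y y-twin = member (twin-coordinates q prim y-twin)
    from : ∀ y → y ∈ map ⟦_⟧ P → Twin ⟦ q ⟧ y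
    from y y∈ = twin (∈-map⁻ ⟦_⟧ y∈)

-- Twins of a vector of squarefree norm

rotate : V3 → V3
rotate (mkV a b c) = mkV b c a

dot-rotate : ∀ a b → dot (rotate a) (rotate b) ≡ dot a b
dot-rotate a b = ring [] (a ∷ b ∷ []) (λ a b → dotᴾ (rotateᴾ a) (rotateᴾ b) := dotᴾ a b) refl

twin-rotate : ∀ q p → Twin q p → Twin (rotate q) (rotate p)
twin-rotate q p (q⊥p , p²≡q²) = trans (dot-rotate q p) q⊥p , trans (dot-rotate p p) (trans p²≡q² (sym (dot-rotate q q)))

cross₁-square : ∀ q p → x₁ (cross q p) * x₁ (cross q p) ≡
  (norm q - x₁ q * x₁ q) * (norm p - x₁ p * x₁ p) - (dot q p - x₁ q * x₁ p) * (dot q p - x₁ q * x₁ p)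
cross₁-square q p = ring [] (q ∷ p ∷ []) (λ q p →
  x₁ᴾ (crossᴾ q p) :* x₁ᴾ (crossᴾ q p)
    := (normᴾ q :- x₁ᴾ q :* x₁ᴾ q) :* (normᴾ p :- x₁ᴾ p :* x₁ᴾ p) :- (dotᴾ q p :- x₁ᴾ q :* x₁ᴾ p) :* (dotᴾ q p :- x₁ᴾ q :* x₁ᴾ p)) refl

∣-cross₁² : ∀ {N} q p → Twin q p → norm q ≡ N → N ∣ x₁ (cross q p) * x₁ (cross q p)
∣-cross₁² {N} q@(mkV q₁ q₂ q₃) p@(mkV p₁ p₂ p₃) (q⊥p , p²≡q²) q²≡N = divides (N - q₁ * q₁ - p₁ * p₁) (begin
  x₁ (cross q p) * x₁ (cross q p)                                                     ≡⟨ cross₁-square q p ⟩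
  (norm q - q₁ * q₁) * (norm p - p₁ * p₁) - (dot q p - q₁ * p₁) * (dot q p - q₁ * p₁) ≡⟨ cong₃ (λ s t d → (s - q₁ * q₁) * (t - p₁ * p₁) - (d - q₁ * p₁) * (d - q₁ * p₁))
                                                                                            q²≡N (trans p²≡q² q²≡N) q⊥p ⟩
  (N - q₁ * q₁) * (N - p₁ * p₁) - (0ℤ - q₁ * p₁) * (0ℤ - q₁ * p₁)                     ≡⟨ factor N q₁ p₁ ⟩
  (N - q₁ * q₁ - p₁ * p₁) * N                                                         ∎)
  where
  factor : ∀ N a b → (N - a * a) * (N - b * b) - (0ℤ - a * b) * (0ℤ - a * b) ≡ (N - a * a - b * b) * N
  factor = solve-∀

·-⊖-zero : ∀ k p q → k · p ⊖ 0ℤ · q ≡ k · p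
·-⊖-zero k p q = ring³ (k ∷ []) (p ∷ q ∷ []) (λ k p q → k ·ᴾ p ⊖ᴾ con 0ℤ ·ᴾ q := k ·ᴾ p) refl refl refl

scaled-cross-twin : ∀ {N} q p t → N ≢ 0ℤ → Twin q p → norm q ≡ N → cross q p ≡ N · t →
                    norm t ≡ 1ℤ × dot q t ≡ 0ℤ × p ≡ cross t q
scaled-cross-twin {N} q p t N≢0 (q⊥p , p²≡q²) q²≡N q×p≡Nt = t²≡1 , q⊥t , p≡t×q
  where
  instance
    N-nonZero : ℤ.NonZero N
    N-nonZero = ℤ.≢-nonZero N≢0
    N²-nonZero : ℤ.NonZero (N * N)
    N²-nonZero = ℤP.i*j≢0 N N
  square-identity : ∀ N → N * N - 0ℤ * 0ℤ ≡ N * N * 1ℤ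
  square-identity = solve-∀
  t²≡1 : norm t ≡ 1ℤ
  t²≡1 = ℤP.*-cancelˡ-≡ (N * N) (norm t) 1ℤ (begin
    N * N * norm t                      ≡⟨ norm-scale N t ⟨
    norm (N · t)                        ≡⟨ cong norm q×p≡Nt ⟨
    norm (cross q p)                    ≡⟨ lagrange q p ⟩
    norm q * norm p - dot q p * dot q p ≡⟨ cong₃ (λ r s d → r * s - d * d) q²≡N (trans p²≡q² q²≡N) q⊥p ⟩
    N * N - 0ℤ * 0ℤ                     ≡⟨ square-identity N ⟩
    N * N * 1ℤ                          ∎)
  q⊥t : dot q t ≡ 0ℤ
  q⊥t = ℤP.*-cancelˡ-≡ N (dot q t) 0ℤ (begin
    N * dot q t       ≡⟨ dot-scaleʳ N q t ⟨
    dot q (N · t)     ≡⟨ cong (dot q) q×p≡Nt ⟨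
    dot q (cross q p) ≡⟨ dot-cross-self q p ⟩
    0ℤ                ≡⟨ ℤP.*-zeroʳ N ⟨
    N * 0ℤ            ∎)
  p≡t×q : p ≡ cross t q
  p≡t×q = ·-cancelˡ N≢0 (begin
    N · p                    ≡⟨ ·-⊖-zero N p q ⟨
    N · p ⊖ 0ℤ · q           ≡⟨ cong₂ (λ r d → r · p ⊖ d · q) q²≡N (trans (dot-comm p q) q⊥p) ⟨
    norm q · p ⊖ dot p q · q ≡⟨ cross-cross q p ⟨
    cross (cross q p) q      ≡⟨ cong (λ z → cross z q) q×p≡Nt ⟩
    cross (N · t) q          ≡⟨ cross-scaleˡ N t q ⟩
    N · cross t q            ∎)

data Axis : Set where
  ax₁ ax₂ ax₃ : Axis

basis : Axis → V3
basis ax₁ = mkV 1ℤ 0ℤ 0ℤ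
basis ax₂ = mkV 0ℤ 1ℤ 0ℤ
basis ax₃ = mkV 0ℤ 0ℤ 1ℤ

coordinate : Axis → V3 → ℤ
coordinate ax₁ = x₁
coordinate ax₂ = x₂
coordinate ax₃ = x₃

dot-basis : ∀ i q → dot q (basis i) ≡ coordinate i q
dot-basis ax₁ q = ring [] (q ∷ []) (λ q → dotᴾ q ⟨ con 1ℤ , con 0ℤ , con 0ℤ ⟩ := x₁ᴾ q) refl
dot-basis ax₂ q = ring [] (q ∷ []) (λ q → dotᴾ q ⟨ con 0ℤ , con 1ℤ , con 0ℤ ⟩ := x₂ᴾ q) refl
dot-basis ax₃ q = ring [] (q ∷ []) (λ q → dotᴾ q ⟨ con 0ℤ , con 0ℤ , con 1ℤ ⟩ := x₃ᴾ q) refl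

dot-signedBasis : ∀ q s i → dot q (s · basis i) ≡ s * coordinate i q
dot-signedBasis q s i = trans (dot-scaleʳ s q (basis i)) (cong (s *_) (dot-basis i q))

data SignedUnit : V3 → Set where
  signed : ∀ {s} i → s ≡ 1ℤ ⊎ s ≡ - 1ℤ → SignedUnit (s · basis i)

axis : ∀ {t} → SignedUnit t → Axis
axis (signed i _) = i

±1≢0 : ∀ {s} → s ≡ 1ℤ ⊎ s ≡ - 1ℤ → s ≢ 0ℤ
±1≢0 (inj₁ refl) ()
±1≢0 (inj₂ refl) ()

∣i∣≡1⇒±1 : ∀ {i} → ∣ i ∣ ≡ 1 → i ≡ 1ℤ ⊎ i ≡ - 1ℤ
∣i∣≡1⇒±1 {+ .1} refl = inj₁ refl
∣i∣≡1⇒±1 { -[1+ 0 ]} refl = inj₂ refl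

orthogonal-axis : ∀ q {t} (t-unit : SignedUnit t) → dot q t ≡ 0ℤ → coordinate (axis t-unit) q ≡ 0ℤ
orthogonal-axis q (signed {s} i ±1) q⊥t = [ (λ s≡0 → ⊥-elim (±1≢0 ±1 s≡0)) , id ]′
  (ℤP.i*j≡0⇒i≡0∨j≡0 s (trans (sym (dot-signedBasis q s i)) q⊥t))

norm≡+∑∣∣² : ∀ a b c → norm (mkV a b c) ≡ + (∣ a ∣ ℕ.* ∣ a ∣ ℕ.+ ∣ b ∣ ℕ.* ∣ b ∣ ℕ.+ ∣ c ∣ ℕ.* ∣ c ∣)
norm≡+∑∣∣² a b c = begin
  a * a + b * b + c * c ≡⟨ cong₃ (λ A B C → A + B + C) (square≡+∣∣² a) (square≡+∣∣² b) (square≡+∣∣² c) ⟩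
  + A + + B + + C       ≡⟨ cong (_+ + C) (ℤP.pos-+ A B) ⟨
  + (A ℕ.+ B) + + C     ≡⟨ ℤP.pos-+ (A ℕ.+ B) C ⟨
  + (A ℕ.+ B ℕ.+ C)     ∎
  where
  A = ∣ a ∣ ℕ.* ∣ a ∣
  B = ∣ b ∣ ℕ.* ∣ b ∣
  C = ∣ c ∣ ℕ.* ∣ c ∣

norm≡1⇒signedUnit : ∀ t → norm t ≡ 1ℤ → SignedUnit t
norm≡1⇒signedUnit (mkV a b c) t²≡1
  with sum-of-squares≡1 (∣ a ∣) (∣ b ∣) (∣ c ∣) (ℤP.+-injective (trans (sym (norm≡+∑∣∣² a b c)) t²≡1))
... | inj₁ (∣a∣≡1 , ∣b∣≡0 , ∣c∣≡0)
  with ∣i∣≡1⇒±1 {a} ∣a∣≡1 | ℤP.∣i∣≡0⇒i≡0 {b} ∣b∣≡0 | ℤP.∣i∣≡0⇒i≡0 {c} ∣c∣≡0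
...   | inj₁ refl | refl | refl = signed ax₁ (inj₁ refl)
...   | inj₂ refl | refl | refl = signed ax₁ (inj₂ refl)
norm≡1⇒signedUnit (mkV a b c) t²≡1 | inj₂ (inj₁ (∣a∣≡0 , ∣b∣≡1 , ∣c∣≡0))
  with ℤP.∣i∣≡0⇒i≡0 {a} ∣a∣≡0 | ∣i∣≡1⇒±1 {b} ∣b∣≡1 | ℤP.∣i∣≡0⇒i≡0 {c} ∣c∣≡0
...   | refl | inj₁ refl | refl = signed ax₂ (inj₁ refl)
...   | refl | inj₂ refl | refl = signed ax₂ (inj₂ refl)
norm≡1⇒signedUnit (mkV a b c) t²≡1 | inj₂ (inj₂ (∣a∣≡0 , ∣b∣≡0 , ∣c∣≡1))
  with ℤP.∣i∣≡0⇒i≡0 {a} ∣a∣≡0 | ℤP.∣i∣≡0⇒i≡0 {b} ∣b∣≡0 | ∣i∣≡1⇒±1 {c} ∣c∣≡1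
...   | refl | refl | inj₁ refl = signed ax₃ (inj₁ refl)
...   | refl | refl | inj₂ refl = signed ax₃ (inj₂ refl)

twin-of-squarefree : ∀ {n} q p → SquareFree n → norm q ≡ + n → Twin q p →
                     ∃ λ t → SignedUnit t × dot q t ≡ 0ℤ × p ≡ cross t q
twin-of-squarefree {n} q p sqf q²≡n twin@(q⊥p , p²≡q²) =
  t , Product.map₁ (norm≡1⇒signedUnit t) (scaled-cross-twin q p t n≢0 twin q²≡n q×p≡n·t)
  where
  n≢0 : + n ≢ 0ℤ
  n≢0 n≡0 = ℕ.≢-nonZero⁻¹ n {{squarefree⇒nonZero sqf}} (ℤP.+-injective n≡0)
  n∣ : ∀ q p → Twin q p → norm q ≡ + n → + n ∣ x₁ (cross q p)
  n∣ q p twin q²≡n = squarefree-∣-squareᶻ sqf (∣-cross₁² q p twin q²≡n)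
  -- rotate permutes the coordinates of q × p cyclically, so n∣ covers all three of them
  n∣z₁ : + n ∣ x₁ (cross q p)
  n∣z₁ = n∣ q p twin q²≡n
  n∣z₂ : + n ∣ x₂ (cross q p)
  n∣z₂ = n∣ (rotate q) (rotate p) (twin-rotate q p twin) (trans (dot-rotate q q) q²≡n)
  n∣z₃ : + n ∣ x₃ (cross q p)
  n∣z₃ = n∣ (rotate (rotate q)) (rotate (rotate p)) (twin-rotate (rotate q) (rotate p) (twin-rotate q p twin))
            (trans (dot-rotate (rotate q) (rotate q)) (trans (dot-rotate q q) q²≡n))
  t : V3
  t = mkV (quotient n∣z₁) (quotient n∣z₂) (quotient n∣z₃)
  q×p≡n·t : cross q p ≡ + n · t
  q×p≡n·t = cong₃ mkV (trans (_∣_.equality n∣z₁) (ℤP.*-comm _ (+ n)))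
                      (trans (_∣_.equality n∣z₂) (ℤP.*-comm _ (+ n)))
                      (trans (_∣_.equality n∣z₃) (ℤP.*-comm _ (+ n)))

coordinate-≢0 : ∀ {a b c} → a ≢ 0ℤ → b ≢ 0ℤ → c ≢ 0ℤ → ∀ i → coordinate i (mkV a b c) ≢ 0ℤ
coordinate-≢0 a≢0 b≢0 c≢0 ax₁ = a≢0
coordinate-≢0 a≢0 b≢0 c≢0 ax₂ = b≢0
coordinate-≢0 a≢0 b≢0 c≢0 ax₃ = c≢0

twin-free : ∀ {n a b c} p → a ≢ 0ℤ → b ≢ 0ℤ → c ≢ 0ℤ → SquareFree n → norm (mkV a b c) ≡ + n →
            ¬ Twin (mkV a b c) p
twin-free {a = a} {b} {c} p a≢0 b≢0 c≢0 sqf q²≡n twin = contradiction (twin-of-squarefree (mkV a b c) p sqf q²≡n twin)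
  where
  contradiction : (∃ λ t → SignedUnit t × dot (mkV a b c) t ≡ 0ℤ × p ≡ cross t (mkV a b c)) → ⊥
  contradiction (t , t-unit , q⊥t , _) = coordinate-≢0 a≢0 b≢0 c≢0 (axis t-unit) (orthogonal-axis (mkV a b c) t-unit q⊥t)

self-negation : ∀ {i} → i ≡ - i → i ≡ 0ℤ
self-negation {+ zero} _ = refl
self-negation {+[1+ n ]} ()
self-negation { -[1+ n ]} ()

twins-across-axis₁ : ∀ {n a b c} → a ≡ 0ℤ → b ≢ 0ℤ → c ≢ 0ℤ → SquareFree n → norm (mkV a b c) ≡ + n →
                     ∀ p → Twin (mkV a b c) p ⇔ p ∈ (mkV 0ℤ c (- b) ∷ mkV 0ℤ (- c) b ∷ [])
twins-across-axis₁ {b = b} {c} refl b≢0 c≢0 sqf q²≡n p =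
  mk⇔ (λ twin → member (twin-of-squarefree (mkV 0ℤ b c) p sqf q²≡n twin)) twin
  where
  member : (∃ λ t → SignedUnit t × dot (mkV 0ℤ b c) t ≡ 0ℤ × p ≡ cross t (mkV 0ℤ b c)) →
           p ∈ (mkV 0ℤ c (- b) ∷ mkV 0ℤ (- c) b ∷ [])
  member (_ , signed ax₁ (inj₁ refl) , _ , p≡t×q) = there (here (trans p≡t×q (ring³ (b ∷ c ∷ []) [] (λ b c →
    crossᴾ ⟨ con 1ℤ , con 0ℤ , con 0ℤ ⟩ ⟨ con 0ℤ , b , c ⟩ := ⟨ con 0ℤ , :- c , b ⟩) refl refl refl)))
  member (_ , signed ax₁ (inj₂ refl) , _ , p≡t×q) = here (trans p≡t×q (ring³ (b ∷ c ∷ []) [] (λ b c →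
    crossᴾ ⟨ con (- 1ℤ) , con 0ℤ , con 0ℤ ⟩ ⟨ con 0ℤ , b , c ⟩ := ⟨ con 0ℤ , c , :- b ⟩) refl refl refl))
  member (_ , t-unit@(signed ax₂ _) , q⊥t , _)    = ⊥-elim (b≢0 (orthogonal-axis (mkV 0ℤ b c) t-unit q⊥t))
  member (_ , t-unit@(signed ax₃ _) , q⊥t , _)    = ⊥-elim (c≢0 (orthogonal-axis (mkV 0ℤ b c) t-unit q⊥t))
  twin : p ∈ (mkV 0ℤ c (- b) ∷ mkV 0ℤ (- c) b ∷ []) → Twin (mkV 0ℤ b c) p
  twin (here refl) =
    ring (b ∷ c ∷ []) [] (λ b c → dotᴾ ⟨ con 0ℤ , b , c ⟩ ⟨ con 0ℤ , c , :- b ⟩ := con 0ℤ) refl ,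
    ring (b ∷ c ∷ []) [] (λ b c → normᴾ ⟨ con 0ℤ , c , :- b ⟩ := normᴾ ⟨ con 0ℤ , b , c ⟩) refl
  twin (there (here refl)) =
    ring (b ∷ c ∷ []) [] (λ b c → dotᴾ ⟨ con 0ℤ , b , c ⟩ ⟨ con 0ℤ , :- c , b ⟩ := con 0ℤ) refl ,
    ring (b ∷ c ∷ []) [] (λ b c → normᴾ ⟨ con 0ℤ , :- c , b ⟩ := normᴾ ⟨ con 0ℤ , b , c ⟩) refl

unique-across-axis₁ : ∀ {b c} → c ≢ 0ℤ → Unique (mkV 0ℤ c (- b) ∷ mkV 0ℤ (- c) b ∷ [])
unique-across-axis₁ c≢0 = ((λ eq → c≢0 (self-negation (cong x₂ eq))) ∷ []) ∷ [] ∷ []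

±e₁±e₂ : List V3
±e₁±e₂ = mkV 1ℤ 0ℤ 0ℤ ∷ mkV (- 1ℤ) 0ℤ 0ℤ ∷ mkV 0ℤ 1ℤ 0ℤ ∷ mkV 0ℤ (- 1ℤ) 0ℤ ∷ []

unique-±e₁±e₂ : Unique ±e₁±e₂
unique-±e₁±e₂ = ((λ ()) ∷ (λ ()) ∷ (λ ()) ∷ []) ∷ ((λ ()) ∷ (λ ()) ∷ []) ∷ ((λ ()) ∷ []) ∷ [] ∷ []

±1-on-axis₃ : ∀ {c} → c ≡ 1ℤ ⊎ c ≡ - 1ℤ → norm (mkV 0ℤ 0ℤ c) ≡ 1ℤ
±1-on-axis₃ (inj₁ refl) = refl
±1-on-axis₃ (inj₂ refl) = refl

twins-on-axis₃ : ∀ {a b c} → a ≡ 0ℤ → b ≡ 0ℤ → c ≡ 1ℤ ⊎ c ≡ - 1ℤ → ∀ p → Twin (mkV a b c) p ⇔ p ∈ ±e₁±e₂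
twins-on-axis₃ {c = c} refl refl ±1 p =
  mk⇔ (λ (q⊥p , p²≡q²) → member q⊥p (norm≡1⇒signedUnit p (trans p²≡q² (±1-on-axis₃ ±1)))) twin
  where
  member : dot (mkV 0ℤ 0ℤ c) p ≡ 0ℤ → SignedUnit p → p ∈ ±e₁±e₂
  member _ (signed ax₁ (inj₁ refl))     = here refl
  member _ (signed ax₁ (inj₂ refl))     = there (here refl)
  member _ (signed ax₂ (inj₁ refl))     = there (there (here refl))
  member _ (signed ax₂ (inj₂ refl))     = there (there (there (here refl)))
  member q⊥p p-unit@(signed ax₃ _) = ⊥-elim (±1≢0 ±1 (orthogonal-axis (mkV 0ℤ 0ℤ c) p-unit q⊥p))
  twin : p ∈ ±e₁±e₂ → Twin (mkV 0ℤ 0ℤ c) p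
  twin (here refl)                         = dot-signedBasis (mkV 0ℤ 0ℤ c) 1ℤ ax₁ , sym (±1-on-axis₃ ±1)
  twin (there (here refl))                 = dot-signedBasis (mkV 0ℤ 0ℤ c) (- 1ℤ) ax₁ , sym (±1-on-axis₃ ±1)
  twin (there (there (here refl)))         = dot-signedBasis (mkV 0ℤ 0ℤ c) 1ℤ ax₂ , sym (±1-on-axis₃ ±1)
  twin (there (there (there (here refl)))) = dot-signedBasis (mkV 0ℤ 0ℤ c) (- 1ℤ) ax₂ , sym (±1-on-axis₃ ±1)

signedUnit-on-axis : ∀ {a b c} → SignedUnit (mkV a b c) → (a ≡ 0ℤ × b ≡ 0ℤ) ⊎ (a ≡ 0ℤ × c ≡ 0ℤ) ⊎ (b ≡ 0ℤ × c ≡ 0ℤ)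
signedUnit-on-axis (signed ax₁ (inj₁ refl)) = inj₂ (inj₂ (refl , refl))
signedUnit-on-axis (signed ax₁ (inj₂ refl)) = inj₂ (inj₂ (refl , refl))
signedUnit-on-axis (signed ax₂ (inj₁ refl)) = inj₂ (inj₁ (refl , refl))
signedUnit-on-axis (signed ax₂ (inj₂ refl)) = inj₂ (inj₁ (refl , refl))
signedUnit-on-axis (signed ax₃ (inj₁ refl)) = inj₁ (refl , refl)
signedUnit-on-axis (signed ax₃ (inj₂ refl)) = inj₁ (refl , refl)

squarefree-square⇒±1 : ∀ {n c} → SquareFree n → c * c ≡ + n → (c ≡ 1ℤ ⊎ c ≡ - 1ℤ) × n ≡ 1
squarefree-square⇒±1 {n} {c} sqf c²≡n = ∣i∣≡1⇒±1 {c} ∣c∣≡1 , trans (sym n≡∣c∣²) (cong (λ k → k ℕ.* k) ∣c∣≡1)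
  where
  n≡∣c∣² : ∣ c ∣ ℕ.* ∣ c ∣ ≡ n
  n≡∣c∣² = ℤP.+-injective (trans (sym (square≡+∣∣² c)) c²≡n)
  ∣c∣≡1 : ∣ c ∣ ≡ 1
  ∣c∣≡1 = sqf ∣ c ∣ (ℕᵈ.divides 1 (sym (trans (ℕP.*-identityˡ _) n≡∣c∣²)))

norm-on-axis₃ : ∀ {a b c} → a ≡ 0ℤ → b ≡ 0ℤ → norm (mkV a b c) ≡ c * c
norm-on-axis₃ {c = c} refl refl = ring (c ∷ []) [] (λ c → normᴾ ⟨ con 0ℤ , con 0ℤ , c ⟩ := c :* c) refl

icube-twins : ∀ {x p q} → IsIcube x p q → Twin x p × Twin x q
icube-twins (_ , _ , _ , x⊥p , x⊥q , _ , x²≡p² , p²≡q²) = (x⊥p , sym x²≡p²) , (x⊥q , sym (trans x²≡p² p²≡q²))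

combine-rotate : ∀ u v w p → combine v w u (rotate p) ≡ combine u v w p
combine-rotate u v w p =
  ring³ [] (u ∷ v ∷ w ∷ p ∷ []) (λ u v w p → combineᴾ v w u (rotateᴾ p) := combineᴾ u v w p) refl refl refl

combine-swap : ∀ u v w a b c → combine u w v (mkV a c b) ≡ combine u v w (mkV a b c)
combine-swap u v w a b c = ring³ (a ∷ b ∷ c ∷ []) (u ∷ v ∷ w ∷ []) (λ a b c u v w →
  combineᴾ u w v ⟨ a , c , b ⟩ := combineᴾ u v w ⟨ a , b , c ⟩) refl refl refl

combine-across-axis₁ : ∀ u v w b c →
  map (combine u v w) (mkV 0ℤ c (- b) ∷ mkV 0ℤ (- c) b ∷ []) ≡ c · v ⊖ b · w ∷ negV (c · v ⊖ b · w) ∷ []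
combine-across-axis₁ u v w b c = cong₂ _∷_
  (ring³ (b ∷ c ∷ []) (u ∷ v ∷ w ∷ []) (λ b c u v w → combineᴾ u v w ⟨ con 0ℤ , c , :- b ⟩ := c ·ᴾ v ⊖ᴾ b ·ᴾ w) refl refl refl)
  (cong₂ _∷_
    (ring³ (b ∷ c ∷ []) (u ∷ v ∷ w ∷ []) (λ b c u v w → combineᴾ u v w ⟨ con 0ℤ , :- c , b ⟩ := negᴾ (c ·ᴾ v ⊖ᴾ b ·ᴾ w)) refl refl refl)
    refl)

combine-±e₁±e₂ : ∀ u v w → map (combine u v w) ±e₁±e₂ ≡ u ∷ negV u ∷ v ∷ negV v ∷ []
combine-±e₁±e₂ u v w =
  cong₂ _∷_ (ring³ [] (u ∷ v ∷ w ∷ []) (λ u v w → combineᴾ u v w ⟨ con 1ℤ , con 0ℤ , con 0ℤ ⟩ := u) refl refl refl)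
  (cong₂ _∷_ (ring³ [] (u ∷ v ∷ w ∷ []) (λ u v w → combineᴾ u v w ⟨ con (- 1ℤ) , con 0ℤ , con 0ℤ ⟩ := negᴾ u) refl refl refl)
  (cong₂ _∷_ (ring³ [] (u ∷ v ∷ w ∷ []) (λ u v w → combineᴾ u v w ⟨ con 0ℤ , con 1ℤ , con 0ℤ ⟩ := v) refl refl refl)
  (cong₂ _∷_ (ring³ [] (u ∷ v ∷ w ∷ []) (λ u v w → combineᴾ u v w ⟨ con 0ℤ , con (- 1ℤ) , con 0ℤ ⟩ := negᴾ v) refl refl refl)
  refl)))

module Classification (x u v w : V3) (a b c μ : ℤ) (n : ℕ) (frame : IsOrthogonalFrame (μ * μ) u v w)
  (μ≢0 : μ ≢ 0ℤ) (sqf : SquareFree n) (x²≡nμ² : norm x ≡ + n * (μ * μ))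
  (x≡⟦q⟧ : x ≡ combine u v w (mkV a b c)) (prim : Primitive x) where

  open Lattice frame μ≢0

  private
    q = mkV a b c

    prim-q : Primitive ⟦ q ⟧
    prim-q = subst Primitive x≡⟦q⟧ prim

    q²≡n : norm q ≡ + n
    q²≡n = ℤP.*-cancelʳ-≡ (norm q) (+ n) (μ * μ) {{ℤP.i*j≢0 μ μ {{ℤ.≢-nonZero μ≢0}} {{ℤ.≢-nonZero μ≢0}}}}
             (trans (sym (dot-⟦⟧ q q)) (trans (cong norm (sym x≡⟦q⟧)) x²≡nμ²))

    twins-of-x : ∀ {L} → TwinsAre ⟦ q ⟧ L → TwinsAre x L
    twins-of-x {L} = subst (λ y → TwinsAre y L) (sym x≡⟦q⟧)

  no-twin : a ≢ 0ℤ → b ≢ 0ℤ → c ≢ 0ℤ → ∀ y → ¬ Twin x y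
  no-twin a≢0 b≢0 c≢0 y twin = contradiction (twin-coordinates q prim-q (subst (λ z → Twin z y) x≡⟦q⟧ twin))
    where
    contradiction : (∃ λ p → Twin q p × y ≡ ⟦ p ⟧) → ⊥
    contradiction (p , q-twin , _) = twin-free {a = a} {b} {c} p a≢0 b≢0 c≢0 sqf q²≡n q-twin

  twins-when-x₁≡0 : a ≡ 0ℤ → b ≢ 0ℤ → c ≢ 0ℤ → TwinsAre x (c · v ⊖ b · w ∷ negV (c · v ⊖ b · w) ∷ [])
  twins-when-x₁≡0 a≡0 b≢0 c≢0 = twins-of-x (subst (TwinsAre ⟦ q ⟧) (combine-across-axis₁ u v w b c)
    (twins-⟦⟧ q prim-q (twins-across-axis₁ {a = a} {b} {c} a≡0 b≢0 c≢0 sqf q²≡n) (unique-across-axis₁ {b} c≢0)))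

  twins-when-x₁≡x₂≡0 : a ≡ 0ℤ → b ≡ 0ℤ →
    (c ≡ 1ℤ ⊎ c ≡ - 1ℤ) × n ≡ 1 × TwinsAre x (u ∷ negV u ∷ v ∷ negV v ∷ []) ×
    (∀ p q → IsIcube x p q → p ∈ (u ∷ negV u ∷ v ∷ negV v ∷ []) × q ∈ (u ∷ negV u ∷ v ∷ negV v ∷ []))
  twins-when-x₁≡x₂≡0 a≡0 b≡0 = ±1 , n≡1 , twins , λ p q icube → Product.map (member p) (member q) (icube-twins icube)
    where
    c²≡n : c * c ≡ + n
    c²≡n = trans (sym (norm-on-axis₃ {a} {b} {c} a≡0 b≡0)) q²≡n
    ±1 : c ≡ 1ℤ ⊎ c ≡ - 1ℤ
    ±1 = proj₁ (squarefree-square⇒±1 {c = c} sqf c²≡n)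
    n≡1 : n ≡ 1
    n≡1 = proj₂ (squarefree-square⇒±1 {c = c} sqf c²≡n)
    twins : TwinsAre x (u ∷ negV u ∷ v ∷ negV v ∷ [])
    twins = twins-of-x (subst (TwinsAre ⟦ q ⟧) (combine-±e₁±e₂ u v w)
      (twins-⟦⟧ q prim-q (twins-on-axis₃ {a} {b} {c} a≡0 b≡0 ±1) unique-±e₁±e₂))
    member : ∀ p → Twin x p → p ∈ (u ∷ negV u ∷ v ∷ negV v ∷ [])
    member p = Equivalence.to (proj₂ twins p)

  square-norm⇒two-zeros : IsPerfectSquare (norm x) → (a ≡ 0ℤ × b ≡ 0ℤ) ⊎ (a ≡ 0ℤ × c ≡ 0ℤ) ⊎ (b ≡ 0ℤ × c ≡ 0ℤ)
  square-norm⇒two-zeros (k , x²≡k²) = signedUnit-on-axis (norm≡1⇒signedUnit q (trans q²≡n (cong +_ n≡1)))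
    where
    n≡1 : n ≡ 1
    n≡1 = squarefree*square≡square⇒≡1 ∣ μ ∣ k {{ℤ.≢-nonZero μ≢0}} sqf (ℤP.+-injective (begin
      + (n ℕ.* (∣ μ ∣ ℕ.* ∣ μ ∣)) ≡⟨ ℤP.pos-* n _ ⟩
      + n * + (∣ μ ∣ ℕ.* ∣ μ ∣)   ≡⟨ cong (+ n *_) (square≡+∣∣² μ) ⟨
      + n * (μ * μ)               ≡⟨ x²≡nμ² ⟨
      norm x                      ≡⟨ x²≡k² ⟩
      + (k ℕ.* k)                 ∎))

corollary1p6 : (x : V3) (n m : ℕ) (u v w : V3) (a b c : ℤ) →
    Primitive x → 0 ℕ.< n → 0 ℕ.< m → SquareFree n →
    norm x ≡ + (n ℕ.* (m ℕ.* m)) →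
    IsIcube u v w → norm u ≡ + (m ℕ.* m) →
    x ≡ a · u ⊕ b · v ⊕ c · w →
    -- (1) none of a, b, c zero: no twin
    ((a ≢ 0ℤ → b ≢ 0ℤ → c ≢ 0ℤ → ∀ y → ¬ Twin x y)
    -- (2) exactly one of a, b, c zero: exactly two twins
    × (a ≡ 0ℤ → b ≢ 0ℤ → c ≢ 0ℤ →
         TwinsAre x (c · v ⊖ b · w ∷ negV (c · v ⊖ b · w) ∷ []))
    × (b ≡ 0ℤ → a ≢ 0ℤ → c ≢ 0ℤ →
         TwinsAre x (a · w ⊖ c · u ∷ negV (a · w ⊖ c · u) ∷ []))
    × (c ≡ 0ℤ → a ≢ 0ℤ → b ≢ 0ℤ →
         TwinsAre x (b · u ⊖ a · v ∷ negV (b · u ⊖ a · v) ∷ []))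
    -- (3) two of a, b, c zero: c = ±1, n = 1, exactly four twins, unique icube
    × (a ≡ 0ℤ → b ≡ 0ℤ →
         (c ≡ 1ℤ ⊎ c ≡ - 1ℤ) × n ≡ 1 ×
         TwinsAre x (u ∷ negV u ∷ v ∷ negV v ∷ []) ×
         (∀ p q → IsIcube x p q →
            p ∈ (u ∷ negV u ∷ v ∷ negV v ∷ []) × q ∈ (u ∷ negV u ∷ v ∷ negV v ∷ [])))
    × (a ≡ 0ℤ → c ≡ 0ℤ →
         (b ≡ 1ℤ ⊎ b ≡ - 1ℤ) × n ≡ 1 ×
         TwinsAre x (u ∷ negV u ∷ w ∷ negV w ∷ []) ×
         (∀ p q → IsIcube x p q →
            p ∈ (u ∷ negV u ∷ w ∷ negV w ∷ []) × q ∈ (u ∷ negV u ∷ w ∷ negV w ∷ [])))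
    × (b ≡ 0ℤ → c ≡ 0ℤ →
         (a ≡ 1ℤ ⊎ a ≡ - 1ℤ) × n ≡ 1 ×
         TwinsAre x (v ∷ negV v ∷ w ∷ negV w ∷ []) ×
         (∀ p q → IsIcube x p q →
            p ∈ (v ∷ negV v ∷ w ∷ negV w ∷ []) × q ∈ (v ∷ negV v ∷ w ∷ negV w ∷ [])))
    -- case (3) happens exactly when norm x is a perfect square
    × (IsPerfectSquare (norm x) ⇔
         ((a ≡ 0ℤ × b ≡ 0ℤ) ⊎ (a ≡ 0ℤ × c ≡ 0ℤ) ⊎ (b ≡ 0ℤ × c ≡ 0ℤ))))
-- 0 < n is implied by SquareFree n.
corollary1p6 x n m u v w a b c prim _ m>0 sqf x²≡nm² icube u²≡m² x≡⟦abc⟧ =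
  uvw.no-twin , uvw.twins-when-x₁≡0 , (λ b≡0 a≢0 c≢0 → vwu.twins-when-x₁≡0 b≡0 c≢0 a≢0) , wuv.twins-when-x₁≡0 ,
  uvw.twins-when-x₁≡x₂≡0 , uwv.twins-when-x₁≡x₂≡0 , vwu.twins-when-x₁≡x₂≡0 ,
  mk⇔ uvw.square-norm⇒two-zeros λ where
    (inj₁ (a≡0 , b≡0))        → square-norm (proj₁ (proj₂ (uvw.twins-when-x₁≡x₂≡0 a≡0 b≡0)))
    (inj₂ (inj₁ (a≡0 , c≡0))) → square-norm (proj₁ (proj₂ (uwv.twins-when-x₁≡x₂≡0 a≡0 c≡0)))
    (inj₂ (inj₂ (b≡0 , c≡0))) → square-norm (proj₁ (proj₂ (vwu.twins-when-x₁≡x₂≡0 b≡0 c≡0)))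
  where
  μ≢0 : + m ≢ 0ℤ
  μ≢0 m≡0 = ℕP.n>0⇒n≢0 m>0 (ℤP.+-injective m≡0)
  frame : IsOrthogonalFrame (+ m * + m) u v w
  frame = icube⇒frame icube (trans u²≡m² (ℤP.pos-* m m))
  x²≡nμ² : norm x ≡ + n * (+ m * + m)
  x²≡nμ² = trans x²≡nm² (trans (ℤP.pos-* n (m ℕ.* m)) (cong (+ n *_) (ℤP.pos-* m m)))
  square-norm : n ≡ 1 → IsPerfectSquare (norm x)
  square-norm n≡1 = m , trans x²≡nm² (cong +_ (trans (cong (ℕ._* (m ℕ.* m)) n≡1) (ℕP.*-identityˡ (m ℕ.* m))))
  module uvw = Classification x u v w a b c (+ m) n frame μ≢0 sqf x²≡nμ² x≡⟦abc⟧ prim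
  module vwu = Classification x v w u b c a (+ m) n (frame-rotate frame) μ≢0 sqf x²≡nμ²
                 (trans x≡⟦abc⟧ (sym (combine-rotate u v w (mkV a b c)))) prim
  module wuv = Classification x w u v c a b (+ m) n (frame-rotate (frame-rotate frame)) μ≢0 sqf x²≡nμ²
                 (trans x≡⟦abc⟧ (sym (trans (combine-rotate v w u (mkV b c a)) (combine-rotate u v w (mkV a b c))))) prim
  module uwv = Classification x u w v a c b (+ m) n (frame-swap frame) μ≢0 sqf x²≡nμ²
                 (trans x≡⟦abc⟧ (sym (combine-swap u v w a b c))) prim
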